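{- Let $\Gamma$ be a finite group and $F$ a $\Gamma$-species. The ordinary cycle index of the quotient species $F/\Gamma$ is $$Z_{F/\Gamma}=\frac1{|\Gamma|}\sum_{\gamma\in\Gamma}Z^{\Gamma}_F(\gamma)=\frac{1}{|\Gamma|}\sum_{\gamma\in\Gamma}\sum_{n\ge0}\frac{1}{n!}\sum_{\sigma\in\mathfrak S_n}\operatorname{fix}(\gamma\cdot F[\sigma])\,p_\sigma .$$
   Context: A species is a functor $F$ from finite sets with bijections to finite sets with maps. A $\Gamma$-species is a species $F$ with an action of $\Gamma$ by species isomorphisms: for each finite set $A$, $\Gamma$ acts on $F[A]$, and $\gamma\cdot F[\sigma](s)=F[\sigma](\gamma\cdot s)$ for every bijection $\sigma:A\to B$, $s\in F[A]$, $\gamma\in\Gamma$. The quotient species $F/\Gamma$ has $(F/\Gamma)[A]$ equal to the set of $\Gamma$-orbits on $F[A]$, with induced transport. For $\sigma\in\mathfrak S_n$, $p_\sigma=\prod_i p_i^{\sigma_i}$ with $\sigma_i$ the number of $i$-cycles of $\sigma$ and $p_1,p_2,\dots$ indeterminates; $\operatorname{fix}$ denotes the number of fixed points of a self-map. $F[\sigma]$ is taken on $F[\{1,\dots,n\}]$. The cycle index of a species is $Z_F=\sum_{n\ge0}\frac1{n!}\sum_{\sigma\in\mathfrak S_n}\operatorname{fix}(F[\sigma])p_\sigma$, and the $\Gamma$-cycle index of a $\Gamma$-species is $Z^\Gamma_F(\gamma)=\sum_{n\ge0}\frac1{n!}\sum_{\sigma\in\mathfrak S_n}\operatorname{fix}(\gamma\cdot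 F[\sigma])p_\sigma$, where $\gamma\cdot F[\sigma]$ is the composite map. -}

module Defs where

open import Algebra.Bundles using (Group)
import Algebra.Properties.CommutativeMonoid.Sum as CMSum
open import Data.Bool.Base using (if_then_else_; true; false)
open import Data.Fin.Base using (Fin; zero; suc; toℕ; fromℕ<; punchIn; combine; remQuot)
import Data.Fin.Properties as Fin
open import Data.Fin.Permutation as Perm using (Permutation′; _⟨$⟩ʳ_; insert; remove)
open import Data.Integer.Base using (+_)
open import Data.Nat.Base as ℕ
  using (ℕ; zero; suc; z≤n; s≤s; _∸_; _≤_; _<_; _⊔_; _!; >-nonZero)
open import Data.Nat.DivMod using (m≡m%n+[m/n]*n; m%n<n)
  renaming (_/_ to _div_; _%_ to _mod_)
import Data.Nat.Properties as ℕ
open import Data.Product.Base using (Σ; ∃; _×_; _,_; proj₁; proj₂)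
open import Data.Rational.Base as ℚ using (ℚ; 0ℚ; 1ℚ; _/_)
import Data.Rational.Properties as ℚ
open import Data.Vec.Base using (Vec; []; _∷_; count; tabulate)
open import Data.Vec.Properties using (count≤n)
open import Function.Base using (_∘_)
open import Function.Bundles using (Func; Inverse; Injection; mk⇔)
import Function.Construct.Composition as Comp
import Function.Construct.Identity as Id
open import Function.Properties.Inverse using (↔⇒↣)
open import Level using (Level; 0ℓ) renaming (suc to lsuc; _⊔_ to _⊔ˡ_)
open import Relation.Binary.Bundles using (Setoid)
open import Relation.Binary.Core using (Rel; _⇒_)
open import Relation.Binary.Definitions using (Decidable)
open import Relation.Binary.PropositionalEquality as ≡
  using (_≡_; refl; sym; trans; cong; cong₂; subst; module ≡-Reasoning)
open import Relation.Binary.Structures using (IsEquivalence)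
open import Relation.Nullary.Decidable using (yes; no; does; map′; dec-no; dec-false; does-⇔)
open import Relation.Nullary.Negation using (¬_; contradiction)
import Relation.Unary as U

open Func using () renaming (to to infixl 10 _⟨$⟩_)

private
  variable
    a ℓ r p c f e : Level
    n : ℕ

mkInverse : (S : Setoid a ℓ) → let open Setoid S in
            (to : Carrier → Fin n) (from : Fin n → Carrier) →
            (∀ {x y} → x ≈ y → to x ≡ to y) →
            (∀ i → to (from i) ≡ i) → (∀ x → from (to x) ≈ x) →
            Inverse S (≡.setoid (Fin n))
mkInverse S to from to-cong invˡ invʳ = record
  { to        = to
  ; from      = from
  ; to-cong   = to-cong
  ; from-cong = λ { refl → Setoid.refl S }
  ; inverse   = (λ {i} y≈ → trans (to-cong y≈) (invˡ i))
              , (λ { {x} refl → invʳ x })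
  }

------------------------------------------------------------------------
-- Finite sets

-- Agda has no quotient types, so a finite set is a setoid in bijection
-- with some Fin n; elements of the set are elements of the carrier up
-- to _≈_.

record FinSet a ℓ : Set (lsuc (a ⊔ˡ ℓ)) where
  field
    setoid : Setoid a ℓ
    card   : ℕ
    enum   : Inverse setoid (≡.setoid (Fin card))

  open Setoid setoid public using (Carrier; _≈_)
  open Inverse enum public using () renaming
    ( to to index; from to element; to-cong to index-cong
    ; strictlyInverseˡ to index-element; strictlyInverseʳ to element-index )

  index-injective : ∀ {x y} → index x ≡ index y → x ≈ y
  index-injective {x} {y} eq = Setoid.trans setoid
    (Setoid.sym setoid (element-index x))
    (Inverse.inverseʳ enum eq)

  _≟_ : Decidable _≈_
  x ≟ y = map′ index-injective index-cong (index x Fin.≟ index y)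

open FinSet public using (Carrier; card)

-- The set {1,…,n}.
⟦_⟧ : ℕ → FinSet 0ℓ 0ℓ
⟦ n ⟧ = record
  { setoid = ≡.setoid (Fin n)
  ; card   = n
  ; enum   = Id.inverse _
  }

infix 2 _⟶_ _≃_

_⟶_ : FinSet a ℓ → FinSet c r → Set _
X ⟶ Y = Func (FinSet.setoid X) (FinSet.setoid Y)

_≃_ : FinSet a ℓ → FinSet c r → Set _
X ≃ Y = Inverse (FinSet.setoid X) (FinSet.setoid Y)

-- The number of elements of X satisfying P (for P invariant under _≈_).
# : (X : FinSet a ℓ) {P : U.Pred (Carrier X) p} → U.Decidable P → ℕ
# X P? = count P? (tabulate (FinSet.element X))

fix : (X : FinSet a ℓ) → X ⟶ X → ℕ
fix X φ = # X (λ x → FinSet._≟_ X (φ ⟨$⟩ x) x)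

quotientFin : ∀ n {R : Rel (Fin n) r} (isEq : IsEquivalence R) → Decidable R →
              Σ ℕ λ k → Inverse (record { isEquivalence = isEq }) (≡.setoid (Fin k))
quotientFin zero isEq R? = zero , mkInverse _ (λ ()) (λ ()) (λ { {()} }) (λ ()) (λ ())
quotientFin (suc n) {R} isEq R?
  with quotientFin n
         {R = λ i j → R (suc i) (suc j)}
         (record { refl  = IsEquivalence.refl isEq
                 ; sym   = IsEquivalence.sym isEq
                 ; trans = IsEquivalence.trans isEq })
         (λ i j → R? (suc i) (suc j))
     | Fin.any? (λ i → R? zero (suc i))
... | k , inv | yes (i₀ , r₀) = k , mkInverse _ to (suc ∘ I.from) to-cong I.strictlyInverseˡ invʳ
  where
  module I = Inverse inv
  module E = IsEquivalence isEq
  to : Fin (suc n) → Fin k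
  to zero    = I.to i₀
  to (suc i) = I.to i
  to-cong : ∀ {x y} → R x y → to x ≡ to y
  to-cong {zero}  {zero}  _ = refl
  to-cong {zero}  {suc y} q = I.to-cong (E.trans (E.sym r₀) q)
  to-cong {suc x} {zero}  q = I.to-cong (E.trans q r₀)
  to-cong {suc x} {suc y} q = I.to-cong q
  invʳ : ∀ x → R (suc (I.from (to x))) x
  invʳ zero    = E.trans (I.strictlyInverseʳ i₀) (E.sym r₀)
  invʳ (suc x) = I.strictlyInverseʳ x
... | k , inv | no ¬r = suc k , mkInverse _ to from to-cong invˡ invʳ
  where
  module I = Inverse inv
  module E = IsEquivalence isEq
  to : Fin (suc n) → Fin (suc k)
  to zero    = zero
  to (suc i) = suc (I.to i)
  from : Fin (suc k) → Fin (suc n)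
  from zero    = zero
  from (suc j) = suc (I.from j)
  to-cong : ∀ {x y} → R x y → to x ≡ to y
  to-cong {zero}  {zero}  _ = refl
  to-cong {zero}  {suc y} q = contradiction (y , q) ¬r
  to-cong {suc x} {zero}  q = contradiction (x , E.sym q) ¬r
  to-cong {suc x} {suc y} q = cong suc (I.to-cong q)
  invˡ : ∀ j → to (from j) ≡ j
  invˡ zero    = refl
  invˡ (suc j) = cong suc (I.strictlyInverseˡ j)
  invʳ : ∀ x → R (from (to x)) x
  invʳ zero    = E.refl
  invʳ (suc x) = I.strictlyInverseʳ x

-- X modulo a decidable equivalence relation R coarser than _≈_: same
-- carrier, with R as equality.
quotient : (X : FinSet a ℓ) {R : Rel (Carrier X) r} → IsEquivalence R →
           FinSet._≈_ X ⇒ R → Decidable R → FinSet a r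
quotient X {R} isEq ≈⇒R R? = record
  { setoid = record { isEquivalence = isEq }
  ; card   = proj₁ q
  ; enum   = mkInverse _ (Q.to ∘ X.index) (X.element ∘ Q.from)
      (λ {x} {y} xRy → Q.to-cong
        (E.trans (≈⇒R (X.element-index x))
          (E.trans xRy (E.sym (≈⇒R (X.element-index y))))))
      (λ i → trans (cong Q.to (X.index-element (Q.from i))) (Q.strictlyInverseˡ i))
      (λ x → E.trans (Q.strictlyInverseʳ (X.index x)) (≈⇒R (X.element-index x)))
  }
  where
  module X = FinSet X
  module E = IsEquivalence isEq
  q = quotientFin X.card
        {R = λ i j → R (X.element i) (X.element j)}
        (record { refl = E.refl ; sym = E.sym ; trans = E.trans })
        (λ i j → R? (X.element i) (X.element j))
  module Q = Inverse (proj₂ q)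

------------------------------------------------------------------------
-- The symmetric group, enumerated by
-- 𝔖 (suc n) ∋ π ↦ (π 0 , remove 0 π) ∈ Fin (suc n) × 𝔖 n

remove₀-cong : {π ρ : Permutation′ (suc n)} → π Perm.≈ ρ →
               remove zero π Perm.≈ remove zero ρ
remove₀-cong {π = π} {ρ} π≈ρ j = Fin.punchIn-injective (π ⟨$⟩ʳ zero) _ _ (begin
  punchIn (π ⟨$⟩ʳ zero) (remove zero π ⟨$⟩ʳ j)  ≡⟨ Perm.punchIn-permute π zero j ⟨
  π ⟨$⟩ʳ suc j                                  ≡⟨ π≈ρ (suc j) ⟩
  ρ ⟨$⟩ʳ suc j                                  ≡⟨ Perm.punchIn-permute ρ zero j ⟩
  punchIn (ρ ⟨$⟩ʳ zero) (remove zero ρ ⟨$⟩ʳ j)  ≡⟨ cong (λ i → punchIn i _) (π≈ρ zero) ⟨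
  punchIn (π ⟨$⟩ʳ zero) (remove zero ρ ⟨$⟩ʳ j)  ∎)
  where open ≡-Reasoning

insert₀-cong : ∀ j {π ρ : Permutation′ n} → π Perm.≈ ρ →
               insert zero j π Perm.≈ insert zero j ρ
insert₀-cong j π≈ρ zero    = refl
insert₀-cong j π≈ρ (suc k) = cong (punchIn j) (π≈ρ _)

encode : ∀ n → Permutation′ n → Fin (n !)
encode zero    π = zero
encode (suc n) π = combine (π ⟨$⟩ʳ zero) (encode n (remove zero π))

decode : ∀ n → Fin (n !) → Permutation′ n
decode zero    i = Perm.id
decode (suc n) i =
  insert zero (proj₁ (remQuot {suc n} (n !) i)) (decode n (proj₂ (remQuot {suc n} (n !) i)))

encode-cong : ∀ n {π ρ : Permutation′ n} → π Perm.≈ ρ → encode n π ≡ encode n ρ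
encode-cong zero    π≈ρ = refl
encode-cong (suc n) {π} {ρ} π≈ρ =
  cong₂ combine (π≈ρ zero) (encode-cong n (remove₀-cong {π = π} {ρ} π≈ρ))

encode-decode : ∀ n i → encode n (decode n i) ≡ i
encode-decode zero    zero = refl
encode-decode (suc n) i = begin
  combine j (encode n (remove zero (insert zero j (decode n k))))
    ≡⟨ cong (combine j) (encode-cong n (Perm.remove-insert zero j (decode n k))) ⟩
  combine j (encode n (decode n k))
    ≡⟨ cong (combine j) (encode-decode n k) ⟩
  combine j k
    ≡⟨ Fin.combine-remQuot {suc n} (n !) i ⟩
  i ∎
  where
  open ≡-Reasoning
  j = proj₁ (remQuot {suc n} (n !) i)
  k = proj₂ (remQuot {suc n} (n !) i)

decode-encode : ∀ n π → decode n (encode n π) Perm.≈ π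
decode-encode zero    π ()
decode-encode (suc n) π i = begin
  decode (suc n) (combine (π ⟨$⟩ʳ zero) k) ⟨$⟩ʳ i
    ≡⟨ cong (λ jk → insert zero (proj₁ jk) (decode n (proj₂ jk)) ⟨$⟩ʳ i)
            (Fin.remQuot-combine (π ⟨$⟩ʳ zero) k) ⟩
  insert zero (π ⟨$⟩ʳ zero) (decode n k) ⟨$⟩ʳ i
    ≡⟨ insert₀-cong (π ⟨$⟩ʳ zero) {decode n k} {remove zero π} (decode-encode n (remove zero π)) i ⟩
  insert zero (π ⟨$⟩ʳ zero) (remove zero π) ⟨$⟩ʳ i
    ≡⟨ Perm.insert-remove zero π i ⟩
  π ⟨$⟩ʳ i ∎
  where
  open ≡-Reasoning
  k = encode n (remove zero π)

𝔖 : ℕ → FinSet 0ℓ 0ℓ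
𝔖 n = record
  { setoid = S
  ; card   = n !
  ; enum   = mkInverse S (encode n) (decode n) (λ {π} {ρ} → encode-cong n {π} {ρ})
                       (encode-decode n) (decode-encode n)
  }
  where
  S : Setoid 0ℓ 0ℓ
  S = record
    { Carrier       = Permutation′ n
    ; _≈_           = Perm._≈_
    ; isEquivalence = record
      { refl  = λ _ → refl
      ; sym   = λ π≈ρ i → sym (π≈ρ i)
      ; trans = λ π≈ρ ρ≈τ i → trans (π≈ρ i) (ρ≈τ i)
      }
    }

------------------------------------------------------------------------
-- Cycles of a permutation: the orbits of its powers

pow : Permutation′ n → ℕ → Fin n → Fin n
pow σ zero    x = x
pow σ (suc k) x = σ ⟨$⟩ʳ pow σ k x

SameCycle : Permutation′ n → Rel (Fin n) 0ℓ
SameCycle σ x y = ∃ λ k → pow σ k x ≡ y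

module Powers {n} (σ : Permutation′ n) where
  pow-+ : ∀ j k x → pow σ (j ℕ.+ k) x ≡ pow σ j (pow σ k x)
  pow-+ zero    k x = refl
  pow-+ (suc j) k x = cong (σ ⟨$⟩ʳ_) (pow-+ j k x)

  pow-injective : ∀ k {x y} → pow σ k x ≡ pow σ k y → x ≡ y
  pow-injective zero    eq = eq
  pow-injective (suc k) eq = pow-injective k (Injection.injective (↔⇒↣ σ) eq)

  period : ∀ x → ∃ λ q → 0 < q × q ≤ n × pow σ q x ≡ x
  period x with Fin.pigeonhole (ℕ.n<1+n n) (λ (i : Fin (suc n)) → pow σ (toℕ i) x)
  ... | i , j , i<j , eq =
    toℕ j ∸ toℕ i
    , ℕ.m<n⇒0<n∸m i<j
    , ℕ.≤-trans (ℕ.m∸n≤m (toℕ j) (toℕ i)) (ℕ.≤-pred (Fin.toℕ<n j))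
    , pow-injective (toℕ i) (begin
        pow σ (toℕ i) (pow σ (toℕ j ∸ toℕ i) x)  ≡⟨ pow-+ (toℕ i) _ x ⟨
        pow σ (toℕ i ℕ.+ (toℕ j ∸ toℕ i)) x      ≡⟨ cong (λ k → pow σ k x) (ℕ.m+[n∸m]≡n (ℕ.<⇒≤ i<j)) ⟩
        pow σ (toℕ j) x                          ≡⟨ eq ⟨
        pow σ (toℕ i) x                          ∎)
    where open ≡-Reasoning

  pow-* : ∀ k {q x} → pow σ q x ≡ x → pow σ (k ℕ.* q) x ≡ x
  pow-* zero    eq = refl
  pow-* (suc k) {q} {x} eq =
    trans (pow-+ q (k ℕ.* q) x) (trans (cong (pow σ q) (pow-* k eq)) eq)

sameCycle-isEquivalence : (σ : Permutation′ n) → IsEquivalence (SameCycle σ)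
sameCycle-isEquivalence σ = record
  { refl  = 0 , refl
  ; sym   = symm
  ; trans = λ { {x} (j , refl) (k , refl) → k ℕ.+ j , pow-+ k j x }
  }
  where
  open Powers σ
  symm : ∀ {x y} → SameCycle σ x y → SameCycle σ y x
  symm {x} (k , refl) with period x
  ... | suc q , _ , _ , eq = k ℕ.* suc q ∸ k , (begin
      pow σ (k ℕ.* suc q ∸ k) (pow σ k x)  ≡⟨ pow-+ (k ℕ.* suc q ∸ k) k x ⟨
      pow σ (k ℕ.* suc q ∸ k ℕ.+ k) x      ≡⟨ cong (λ j → pow σ j x) (ℕ.m∸n+n≡m (ℕ.m≤m*n k (suc q))) ⟩
      pow σ (k ℕ.* suc q) x                ≡⟨ pow-* k eq ⟩
      x                                    ∎)
      where open ≡-Reasoning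

sameCycle? : (σ : Permutation′ n) → Decidable (SameCycle σ)
sameCycle? {n} σ x y =
  map′ (λ (i , eq) → toℕ i , eq) small (Fin.any? (λ (i : Fin n) → pow σ (toℕ i) x Fin.≟ y))
  where
  open Powers σ
  small : SameCycle σ x y → ∃ λ (i : Fin n) → pow σ (toℕ i) x ≡ y
  small (k , refl) with period x
  ... | suc q , _ , q≤n , eq = fromℕ< k%q<n , (begin
      pow σ (toℕ (fromℕ< k%q<n)) x                        ≡⟨ cong (λ j → pow σ j x) (Fin.toℕ-fromℕ< k%q<n) ⟩
      pow σ (k mod suc q) x                               ≡⟨ cong (pow σ (k mod suc q)) (pow-* (k div suc q) eq) ⟨
      pow σ (k mod suc q) (pow σ (k div suc q ℕ.* suc q) x) ≡⟨ pow-+ (k mod suc q) _ x ⟨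
      pow σ (k mod suc q ℕ.+ k div suc q ℕ.* suc q) x     ≡⟨ cong (λ j → pow σ j x) (m≡m%n+[m/n]*n k (suc q)) ⟨
      pow σ k x                                           ∎)
      where
      open ≡-Reasoning
      k%q<n : k mod suc q < n
      k%q<n = ℕ.<-≤-trans (m%n<n k (suc q)) q≤n

cycles : Permutation′ n → FinSet 0ℓ 0ℓ
cycles {n} σ = quotient ⟦ n ⟧ (sameCycle-isEquivalence σ) (λ { refl → 0 , refl }) (sameCycle? σ)

-- The length of the cycle containing x.
cycleLength : Permutation′ n → Fin n → ℕ
cycleLength {n} σ x = # ⟦ n ⟧ (sameCycle? σ x)

-- σᵢ in the notation of cycle indices.
numCycles : Permutation′ n → ℕ → ℕ
numCycles σ i = # (cycles σ) (λ x → cycleLength σ x ℕ.≟ i)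

------------------------------------------------------------------------
-- Formal power series over ℚ in the indeterminates p₁, p₂, …

-- The monomial ∏ᵢ pᵢ₊₁ ^ exponent i, with i ranging over ℕ.
record Monomial : Set where
  field
    exponent : ℕ → ℕ
    bound    : ℕ
    vanish   : ∀ i → bound ≤ i → exponent i ≡ 0

open Monomial

-- The bound is not part of the monomial.
monomials : Setoid 0ℓ 0ℓ
monomials = record
  { Carrier       = Monomial
  ; _≈_           = λ m m′ → ∀ i → exponent m i ≡ exponent m′ i
  ; isEquivalence = record
    { refl  = λ _ → refl
    ; sym   = λ p i → sym (p i)
    ; trans = λ p q i → trans (p i) (q i)
    }
  }

module Mon = Setoid monomials

_≟ᵐ_ : Decidable Mon._≈_
m ≟ᵐ m′ = map′ everywhere (λ eq i → eq (toℕ i))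
               (Fin.all? {n = b} (λ i → exponent m (toℕ i) ℕ.≟ exponent m′ (toℕ i)))
  where
  b = bound m ⊔ bound m′
  everywhere : (∀ (i : Fin b) → exponent m (toℕ i) ≡ exponent m′ (toℕ i)) → m Mon.≈ m′
  everywhere eq i with i ℕ.<? b
  ... | yes i<b = subst (λ j → exponent m j ≡ exponent m′ j) (Fin.toℕ-fromℕ< i<b) (eq (fromℕ< i<b))
  ... | no  i≮b = trans
    (vanish m i (ℕ.≤-trans (ℕ.m≤m⊔n (bound m) (bound m′)) (ℕ.≮⇒≥ i≮b)))
    (sym (vanish m′ i (ℕ.≤-trans (ℕ.m≤n⊔m (bound m) (bound m′)) (ℕ.≮⇒≥ i≮b))))

-- A power series is its family of coefficients.
PowerSeries : Set
PowerSeries = Func monomials (≡.setoid ℚ)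

infix 4 _≋_
_≋_ : Rel PowerSeries 0ℓ
s ≋ t = ∀ m → s ⟨$⟩ m ≡ t ⟨$⟩ m

infixr 7 _•_
_•_ : ℚ → PowerSeries → PowerSeries
q • s = record
  { to   = λ m → q ℚ.* (s ⟨$⟩ m)
  ; cong = λ m≈m′ → cong (q ℚ.*_) (Func.cong s m≈m′)
  }

module ℚΣ = CMSum ℚ.+-0-commutativeMonoid
module ℕΣ = CMSum ℕ.+-0-commutativeMonoid

∑ : (X : FinSet a ℓ) → (Carrier X → PowerSeries) → PowerSeries
∑ X s = record
  { to   = λ m → ℚΣ.sum (λ i → s (FinSet.element X i) ⟨$⟩ m)
  ; cong = λ m≈m′ → ℚΣ.sum-cong-≗ (λ i → Func.cong (s (FinSet.element X i)) m≈m′)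
  }

infixr 7 ∑
syntax ∑ X (λ x → s) = ∑[ x ∈ X ] s

Summable : (ℕ → PowerSeries) → Set
Summable s = ∀ m → ∃ λ N → ∀ n → N ≤ n → s n ⟨$⟩ m ≡ 0ℚ

sumBelow : ℕ → (ℕ → ℚ) → ℚ
sumBelow N g = ℚΣ.sum {N} (λ i → g (toℕ i))

sumBelow-zero : ∀ N g → (∀ n → g n ≡ 0ℚ) → 0ℚ ≡ sumBelow N g
sumBelow-zero zero    g g≡0 = refl
sumBelow-zero (suc N) g g≡0 =
  cong₂ ℚ._+_ (sym (g≡0 0)) (sumBelow-zero N (g ∘ suc) (g≡0 ∘ suc))

sumBelow-stable : ∀ N M g → (∀ n → N ≤ n → g n ≡ 0ℚ) → (∀ n → M ≤ n → g n ≡ 0ℚ) →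
                  sumBelow N g ≡ sumBelow M g
sumBelow-stable zero    M       g p q = sumBelow-zero M g (λ n → p n z≤n)
sumBelow-stable (suc N) zero    g p q = sym (sumBelow-zero (suc N) g (λ n → q n z≤n))
sumBelow-stable (suc N) (suc M) g p q = cong (g 0 ℚ.+_)
  (sumBelow-stable N M (g ∘ suc) (λ n → p (suc n) ∘ s≤s) (λ n → q (suc n) ∘ s≤s))

-- The sum over all n ≥ 0; each coefficient is a finite sum, which by
-- sumBelow-stable does not depend on the choice of N.
∑∞ : (s : ℕ → PowerSeries) → Summable s → PowerSeries
∑∞ s summable = record
  { to   = λ m → sumBelow (proj₁ (summable m)) (λ n → s n ⟨$⟩ m)
  ; cong = λ {m} {m′} m≈m′ → trans
      (sumBelow-stable (proj₁ (summable m)) (proj₁ (summable m′)) (λ n → s n ⟨$⟩ m)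
        (proj₂ (summable m))
        (λ n N≤n → trans (Func.cong (s n) m≈m′) (proj₂ (summable m′) n N≤n)))
      (ℚΣ.sum-cong-≗ {proj₁ (summable m′)} (λ i → Func.cong (s (toℕ i)) m≈m′))
  }

monomial : Monomial → PowerSeries
monomial m₀ = record
  { to   = λ m → if does (m₀ ≟ᵐ m) then 1ℚ else 0ℚ
  ; cong = λ {m} {m′} m≈m′ → cong (λ b → if b then 1ℚ else 0ℚ)
      (does-⇔ (mk⇔ (λ p → Mon.trans {m₀} {m} {m′} p m≈m′)
                   (λ p → Mon.trans {m₀} {m′} {m} p (Mon.sym {m} {m′} m≈m′)))
              (m₀ ≟ᵐ m) (m₀ ≟ᵐ m′))
  }

count-none : ∀ {A : Set a} {P : U.Pred A p} (P? : U.Decidable P) →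
             (∀ x → ¬ P x) → ∀ {k} (xs : Vec A k) → count P? xs ≡ 0
count-none P? ¬P []       = refl
count-none P? ¬P (x ∷ xs) rewrite dec-no (P? x) (¬P x) = count-none P? ¬P xs

cycleType : Permutation′ n → Monomial
cycleType {n} σ = record
  { exponent = λ i → numCycles σ (suc i)
  ; bound    = n
  ; vanish   = λ i n≤i → count-none (λ x → cycleLength σ x ℕ.≟ suc i)
      (λ x len≡ → ℕ.<-irrefl refl
        (ℕ.≤-<-trans (ℕ.≤-trans (ℕ.≤-reflexive (sym len≡))
          (count≤n (sameCycle? σ x) (tabulate (FinSet.element ⟦ n ⟧)))) (s≤s n≤i)))
      (tabulate (FinSet.element (cycles σ)))
  }

p⟨_⟩ : Permutation′ n → PowerSeries
p⟨ σ ⟩ = monomial (cycleType σ)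

ℕ⇒ℚ : ℕ → ℚ
ℕ⇒ℚ k = + k / 1

1/_! : ℕ → ℚ
1/ n ! = _/_ (+ 1) (n !) {{n ℕ.!≢0}}

count-tabulate : ∀ {A : Set a} {B : Set c} {P : U.Pred A p} {Q : U.Pred B r}
                 (P? : U.Decidable P) (Q? : U.Decidable Q) →
                 ∀ {k} (g : Fin k → A) (h : Fin k → B) →
                 (∀ j → P (g j) → Q (h j)) → (∀ j → Q (h j) → P (g j)) →
                 count P? (tabulate g) ≡ count Q? (tabulate h)
count-tabulate P? Q? {zero}  g h to from = refl
count-tabulate P? Q? {suc k} g h to from
  with ih ← count-tabulate P? Q? (g ∘ suc) (h ∘ suc) (to ∘ suc) (from ∘ suc)
  with P? (g zero) | Q? (h zero)
... | yes _ | yes _ = cong suc ih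
... | yes p | no ¬q = contradiction (to zero p) ¬q
... | no ¬p | yes q = contradiction (from zero q) ¬p
... | no _  | no _  = ih

count>0 : ∀ {A : Set a} {P : U.Pred A p} (P? : U.Decidable P) {k} (g : Fin k → A) j →
          P (g j) → 0 < count P? (tabulate g)
count>0 P? {suc k} g j pj with P? (g zero) | j
... | yes _ | _      = s≤s z≤n
... | no ¬p | zero   = contradiction pj ¬p
... | no _  | suc j′ = count>0 P? (g ∘ suc) j′ pj

sum-indicator : ∀ {k} (i : Fin k) → ℕΣ.sum (λ j → if does (i Fin.≟ j) then 1 else 0) ≡ 1
sum-indicator {suc k} zero    = cong suc (ℕΣ.sum-replicate-zero k)
sum-indicator {suc k} (suc i) = sum-indicator i

fibres : ∀ {k l} (φ : Fin k → Fin l) →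
         ℕΣ.sum (λ j → count (λ i → φ i Fin.≟ j) (tabulate (λ i → i))) ≡ k
fibres {l = l} φ = go (tabulate (λ i → i))
  where
  go : ∀ {k} (xs : Vec _ k) → ℕΣ.sum (λ j → count (λ i → φ i Fin.≟ j) xs) ≡ k
  go []       = ℕΣ.sum-replicate-zero l
  go (x ∷ xs) = begin
    ℕΣ.sum (λ j → count (λ i → φ i Fin.≟ j) (x ∷ xs))
      ≡⟨ ℕΣ.sum-cong-≗ (λ j → split (does (φ x Fin.≟ j)) (count (λ i → φ i Fin.≟ j) xs)) ⟩
    ℕΣ.sum (λ j → (if does (φ x Fin.≟ j) then 1 else 0) ℕ.+ count (λ i → φ i Fin.≟ j) xs)
      ≡⟨ ℕΣ.∑-distrib-+ (λ j → if does (φ x Fin.≟ j) then 1 else 0) _ ⟩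
    ℕΣ.sum (λ j → if does (φ x Fin.≟ j) then 1 else 0)
      ℕ.+ ℕΣ.sum (λ j → count (λ i → φ i Fin.≟ j) xs)
      ≡⟨ cong₂ ℕ._+_ (sum-indicator (φ x)) (go xs) ⟩
    suc _ ∎
    where
    open ≡-Reasoning
    split : ∀ b q → (if b then suc else (λ z → z)) q ≡ (if b then 1 else 0) ℕ.+ q
    split true  q = refl
    split false q = refl

sum≤* : ∀ k {K} (φ : Fin k → ℕ) → (∀ i → φ i ≤ K) → ℕΣ.sum φ ≤ k ℕ.* K
sum≤* zero    φ φ≤K = z≤n
sum≤* (suc k) φ φ≤K = ℕ.+-mono-≤ (φ≤K zero) (sum≤* k (φ ∘ suc) (φ≤K ∘ suc))

degreeBound : Monomial → ℕ
degreeBound m = ℕΣ.sum {bound m} (λ i → exponent m (toℕ i)) ℕ.* bound m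

cycleType-bound : (σ : Permutation′ n) (m : Monomial) → cycleType σ Mon.≈ m → n ≤ degreeBound m
cycleType-bound {n} σ m eq = begin
  n                                  ≡⟨ fibres C.index ⟨
  ℕΣ.sum (λ j → count (λ i → C.index i Fin.≟ j) (tabulate (λ i → i)))
                                     ≡⟨ ℕΣ.sum-cong-≗ {C.card} fibre ⟩
  ℕΣ.sum {C.card} len                ≤⟨ sum≤* C.card len len≤K ⟩
  C.card ℕ.* K                       ≡⟨ cong (ℕ._* K) (fibres len-1) ⟨
  ℕΣ.sum (λ i → count (λ j → len-1 j Fin.≟ i) (tabulate (λ j → j))) ℕ.* K
                                     ≡⟨ cong (ℕ._* K) (ℕΣ.sum-cong-≗ {K} number) ⟩
  degreeBound m                      ∎
  where
  open ℕ.≤-Reasoning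
  module C = FinSet (cycles σ)
  K = bound m
  len : Fin C.card → ℕ
  len j = cycleLength σ (C.element j)

  fibre : ∀ j → count (λ i → C.index i Fin.≟ j) (tabulate (λ i → i)) ≡ len j
  fibre j = count-tabulate (λ i → C.index i Fin.≟ j) (sameCycle? σ (C.element j)) (λ i → i) (λ i → i)
    (λ { i refl → C.element-index i })
    (λ i same → trans (C.index-cong (Setoid.sym C.setoid same)) (C.index-element j))

  len≤K : ∀ j → len j ≤ K
  len≤K j with len j in len≡
  ... | zero  = z≤n
  ... | suc i with i ℕ.<? K
  ...   | yes i<K = i<K
  ...   | no  i≮K = contradiction
    (subst (0 <_) (trans (eq i) (vanish m i (ℕ.≮⇒≥ i≮K)))
      (count>0 (λ x → cycleLength σ x ℕ.≟ suc i) C.element j len≡))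
    (ℕ.<-irrefl refl)

  0<len : ∀ j → 0 < len j
  0<len j = count>0 (sameCycle? σ (C.element j)) (λ i → i) (C.element j) (0 , refl)

  suc-pred : ∀ j → suc (ℕ.pred (len j)) ≡ len j
  suc-pred j = ℕ.suc-pred (len j) {{>-nonZero (0<len j)}}

  pred<K : ∀ j → ℕ.pred (len j) < K
  pred<K j = ℕ.≤-trans (ℕ.≤-reflexive (suc-pred j)) (len≤K j)

  len-1 : Fin C.card → Fin K
  len-1 j = fromℕ< (pred<K j)

  number : ∀ i → count (λ j → len-1 j Fin.≟ i) (tabulate (λ j → j)) ≡ exponent m (toℕ i)
  number i = trans
    (count-tabulate (λ j → len-1 j Fin.≟ i) (λ x → cycleLength σ x ℕ.≟ suc (toℕ i)) (λ j → j) C.element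
      (λ { j refl → trans (sym (suc-pred j)) (cong suc (sym (Fin.toℕ-fromℕ< (pred<K j)))) })
      (λ j len≡ → Fin.toℕ-injective
        (trans (Fin.toℕ-fromℕ< (pred<K j)) (cong ℕ.pred len≡))))
    (eq (toℕ i))

-- Only finitely many n admit a permutation of Fin n with a given cycle type.
permutationSums-summable : (w : ∀ n → Permutation′ n → ℕ) →
  Summable (λ n → 1/ n ! • ∑[ σ ∈ 𝔖 n ] ℕ⇒ℚ (w n σ) • p⟨ σ ⟩)
permutationSums-summable w m = suc (degreeBound m) , λ n N≤n → begin
  1/ n ! ℚ.* ℚΣ.sum {n !} (λ i → term n (element n i))
    ≡⟨ cong (1/ n ! ℚ.*_) (ℚΣ.sum-cong-≗ {n !} (λ i → term≡0 N≤n (element n i))) ⟩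
  1/ n ! ℚ.* ℚΣ.sum {n !} (λ _ → 0ℚ)
    ≡⟨ cong (1/ n ! ℚ.*_) (ℚΣ.sum-replicate-zero (n !)) ⟩
  1/ n ! ℚ.* 0ℚ
    ≡⟨ ℚ.*-zeroʳ 1/ n ! ⟩
  0ℚ ∎
  where
  open ≡-Reasoning
  element : ∀ n → Fin (n !) → Permutation′ n
  element n = FinSet.element (𝔖 n)
  term : ∀ n → Permutation′ n → ℚ
  term n σ = (ℕ⇒ℚ (w n σ) • p⟨ σ ⟩) ⟨$⟩ m
  term≡0 : ∀ {n} → degreeBound m < n → ∀ σ → term n σ ≡ 0ℚ
  term≡0 {n} N≤n σ = trans
    (cong (λ b → ℕ⇒ℚ (w n σ) ℚ.* (if b then 1ℚ else 0ℚ))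
      (dec-false (cycleType σ ≟ᵐ m) (λ eq → ℕ.<⇒≱ N≤n (cycleType-bound σ m eq))))
    (ℚ.*-zeroʳ (ℕ⇒ℚ (w n σ)))

------------------------------------------------------------------------
-- Species

-- A functor from finite sets and bijections to finite sets and maps.
record Species f e : Set (lsuc (0ℓ ⊔ˡ f ⊔ˡ e)) where
  field
    F₀     : FinSet 0ℓ 0ℓ → FinSet f e
    F₁     : ∀ {A B} → A ≃ B → F₀ A ⟶ F₀ B
    F-cong : ∀ {A B} {σ τ : A ≃ B} →
             (∀ x → FinSet._≈_ B (Inverse.to σ x) (Inverse.to τ x)) →
             ∀ s → FinSet._≈_ (F₀ B) (F₁ {A} {B} σ ⟨$⟩ s) (F₁ {A} {B} τ ⟨$⟩ s)
    F-id   : ∀ {A} s → FinSet._≈_ (F₀ A) (F₁ {A} {A} (Id.inverse (FinSet.setoid A)) ⟨$⟩ s) s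
    F-∘    : ∀ {A B C} (σ : A ≃ B) (τ : B ≃ C) s →
             FinSet._≈_ (F₀ C) (F₁ {A} {C} (Comp.inverse σ τ) ⟨$⟩ s)
               (F₁ {B} {C} τ ⟨$⟩ (F₁ {A} {B} σ ⟨$⟩ s))

cycleIndex : Species f e → PowerSeries
cycleIndex F =
  ∑∞ (λ n → 1/ n ! • ∑[ σ ∈ 𝔖 n ] ℕ⇒ℚ (fix (F₀ ⟦ n ⟧) (F₁ σ)) • p⟨ σ ⟩)
     (permutationSums-summable (λ n σ → fix (F₀ ⟦ n ⟧) (F₁ σ)))
  where open Species F

record FiniteGroup c ℓ : Set (lsuc (c ⊔ˡ ℓ)) where
  field
    group : Group c ℓ
    order : ℕ
    enum  : Inverse (Group.setoid group) (≡.setoid (Fin order))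

  open Group group public using (_≈_; _∙_; ε; _⁻¹)

  finSet : FinSet c ℓ
  finSet = record { setoid = Group.setoid group ; card = order ; enum = enum }

1/∣_∣ : FiniteGroup c ℓ → ℚ
1/∣ Γ ∣ = _/_ (+ 1) order {{Fin.nonZeroIndex (Inverse.to enum ε)}}
  where open FiniteGroup Γ

record ΓSpecies (Γ : FiniteGroup c ℓ) f e : Set (c ⊔ˡ ℓ ⊔ˡ lsuc (f ⊔ˡ e)) where
  module Γ = FiniteGroup Γ
  field
    species : Species f e

  open Species species public

  field
    act      : Carrier Γ.finSet → ∀ A → F₀ A ⟶ F₀ A
    act-cong : ∀ {γ δ} → γ Γ.≈ δ → ∀ A s → FinSet._≈_ (F₀ A) (act γ A ⟨$⟩ s) (act δ A ⟨$⟩ s)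
    act-ε    : ∀ A s → FinSet._≈_ (F₀ A) (act Γ.ε A ⟨$⟩ s) s
    act-∙    : ∀ γ δ A s → FinSet._≈_ (F₀ A) (act (γ Γ.∙ δ) A ⟨$⟩ s) (act γ A ⟨$⟩ (act δ A ⟨$⟩ s))
    natural  : ∀ γ {A B} (σ : A ≃ B) s →
               FinSet._≈_ (F₀ B) (act γ B ⟨$⟩ (F₁ {A} {B} σ ⟨$⟩ s))
                                (F₁ {A} {B} σ ⟨$⟩ (act γ A ⟨$⟩ s))

  -- The composite map γ · F[σ].
  infixr 8 _·F₁_
  _·F₁_ : Carrier Γ.finSet → ∀ {A B} → A ≃ B → F₀ A ⟶ F₀ B
  _·F₁_ γ {A} {B} σ = Comp.function (F₁ {A} {B} σ) (act γ B)

  SameOrbit : ∀ A → Rel (Carrier (F₀ A)) (c ⊔ˡ e)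
  SameOrbit A s t = ∃ λ γ → FinSet._≈_ (F₀ A) (act γ A ⟨$⟩ s) t

  ≈⇒sameOrbit : ∀ A {s t} → FinSet._≈_ (F₀ A) s t → SameOrbit A s t
  ≈⇒sameOrbit A {s} s≈t = Γ.ε , Setoid.trans (FinSet.setoid (F₀ A)) (act-ε A s) s≈t

  sameOrbit-isEquivalence : ∀ A → IsEquivalence (SameOrbit A)
  sameOrbit-isEquivalence A = record
    { refl  = ≈⇒sameOrbit A S.refl
    ; sym   = λ { {s} {t} (γ , γs≈t) → γ Γ.⁻¹ ,
        S.trans (Func.cong (act (γ Γ.⁻¹) A) (S.sym γs≈t))
       (S.trans (S.sym (act-∙ (γ Γ.⁻¹) γ A s))
       (S.trans (act-cong (Group.inverseˡ Γ.group γ) A s) (act-ε A s))) }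
    ; trans = λ { {s} {t} {u} (γ , γs≈t) (δ , δt≈u) → δ Γ.∙ γ ,
        S.trans (act-∙ δ γ A s) (S.trans (Func.cong (act δ A) γs≈t) δt≈u) }
    }
    where module S = Setoid (FinSet.setoid (F₀ A))

  sameOrbit? : ∀ A → Decidable (SameOrbit A)
  sameOrbit? A s t = map′
    (λ (i , eq) → G.element i , eq)
    (λ (γ , eq) → G.index γ , S.trans (act-cong (G.element-index γ) A s) eq)
    (Fin.any? (λ i → FinSet._≟_ (F₀ A) (act (G.element i) A ⟨$⟩ s) t))
    where
    module S = Setoid (FinSet.setoid (F₀ A))
    module G = FinSet Γ.finSet

ΓcycleIndex : {Γ : FiniteGroup c ℓ} → ΓSpecies Γ f e → Carrier (FiniteGroup.finSet Γ) → PowerSeries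
ΓcycleIndex F γ =
  ∑∞ (λ n → 1/ n ! • ∑[ σ ∈ 𝔖 n ] ℕ⇒ℚ (fix (F₀ ⟦ n ⟧) (γ ·F₁ σ)) • p⟨ σ ⟩)
     (permutationSums-summable (λ n σ → fix (F₀ ⟦ n ⟧) (γ ·F₁ σ)))
  where open ΓSpecies F

quotientSpecies : {Γ : FiniteGroup c ℓ} → ΓSpecies Γ f e → Species f (c ⊔ˡ e)
quotientSpecies F = record
  { F₀     = λ A → quotient (F₀ A) (sameOrbit-isEquivalence A) (≈⇒sameOrbit A) (sameOrbit? A)
  ; F₁     = λ {A} {B} σ → record
    { to   = F₁ {A} {B} σ ⟨$⟩_
    ; cong = λ { {s} {t} (γ , γs≈t) → γ ,
        Setoid.trans (FinSet.setoid (F₀ B)) (natural γ {A} {B} σ s)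
                                            (Func.cong (F₁ {A} {B} σ) γs≈t) }
    }
  ; F-cong = λ {A} {B} {σ} {τ} σ≈τ s → ≈⇒sameOrbit B (F-cong {A} {B} {σ} {τ} σ≈τ s)
  ; F-id   = λ {A} s → ≈⇒sameOrbit A (F-id {A} s)
  ; F-∘    = λ {A} {B} {C} σ τ s → ≈⇒sameOrbit C (F-∘ {A} {B} {C} σ τ s)
  }
  where open ΓSpecies F

{-# OPTIONS --safe #-}

-- Fix σ ∈ 𝔖ₙ and write φ = F[σ], which commutes with Γ.  By linearity
-- and comparison of coefficients it is enough to show
-- Σ_γ fix(γ·φ) = |Γ| fix(φ/Γ).  The left side is Σ_s #{γ | γ·φ(s) = s};
-- group the s by orbits.  An orbit not fixed by φ contributes nothing.
-- If φ fixes the orbit of q then, for each s in it, q and φ(s) lie in one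
-- orbit, so right translation in Γ gives #{γ | γ·φ(s) = s} = #{γ | γ·q = s},
-- and the latter sum to |Γ| over s.

module Submission where

open import Defs
open import Algebra.Bundles using (Group; CommutativeMonoid; CommutativeRing)
import Algebra.Properties.CommutativeSemigroup as CommutativeSemigroupProperties
import Algebra.Properties.Semiring.Sum as SemiringSum
open import Data.Bool.Base using (if_then_else_; true; false)
open import Data.Fin.Base using (Fin; zero; suc; toℕ)
import Data.Fin.Properties as Fin
open import Data.Fin.Permutation using (Permutation′; permutation)
import Data.Integer.Base as ℤ
import Data.Integer.Properties as ℤ
open import Data.Nat.Base as ℕ using (ℕ; zero; suc; _!)
import Data.Nat.Properties as ℕ
open import Data.Product.Base using (_×_; _,_; proj₁)
open import Data.Rational.Base as ℚ using (ℚ)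
import Data.Rational.Properties as ℚ
import Data.Rational.Unnormalised.Base as ℚᵘ
import Data.Rational.Unnormalised.Properties as ℚᵘ
open import Data.Vec.Base using (count; tabulate)
open import Function.Base using (_∘_)
open import Function.Bundles using (Func; mk⇔)
open import Level using (Level; 0ℓ)
open import Relation.Binary.Bundles using (Setoid)
open import Relation.Binary.PropositionalEquality
  using (_≡_; refl; sym; trans; cong; cong₂; module ≡-Reasoning)
open import Relation.Binary.Structures using (IsEquivalence)
open import Relation.Nullary.Decidable using (Dec; yes; no; does; does-⇔)
open import Relation.Nullary.Negation using (¬_)
import Relation.Unary as U

open Func using () renaming (to to infixl 10 _⟨$⟩_)

private
  variable
    a b c ℓ r p q e f : Level
    A : Set a
    P : Set p
    Q : Set q

module ℕS = SemiringSum ℕ.+-*-semiring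
module ℚS = SemiringSum (CommutativeRing.semiring ℚ.+-*-commutativeRing)
open CommutativeSemigroupProperties
  (CommutativeMonoid.commutativeSemigroup ℚ.*-1-commutativeMonoid) using (x∙yz≈y∙xz)

-- Counting in finite sets

𝟙 : Dec P → ℕ
𝟙 P? = if does P? then 1 else 0

𝟙-cong : (P? : Dec P) (Q? : Dec Q) → (P → Q) → (Q → P) → 𝟙 P? ≡ 𝟙 Q?
𝟙-cong P? Q? to from = cong (if_then 1 else 0) (does-⇔ (mk⇔ to from) P? Q?)

-- For two weighted indicators whose conditions differ: the weights are compared where both
-- conditions hold, and a weight must vanish where only its own condition does.
𝟙-*-cong : ∀ {m n} (P? : Dec P) (Q? : Dec Q) →
           (P → Q → m ≡ n) → (P → ¬ Q → m ≡ 0) → (¬ P → Q → n ≡ 0) →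
           𝟙 P? ℕ.* m ≡ 𝟙 Q? ℕ.* n
𝟙-*-cong (yes p) (yes q) m≡n m≡0 n≡0 = cong (1 ℕ.*_) (m≡n p q)
𝟙-*-cong (yes p) (no ¬q) m≡n m≡0 n≡0 = cong (1 ℕ.*_) (m≡0 p ¬q)
𝟙-*-cong (no ¬p) (yes q) m≡n m≡0 n≡0 = cong (1 ℕ.*_) (sym (n≡0 ¬p q))
𝟙-*-cong (no _)  (no _)  m≡n m≡0 n≡0 = refl

-- The sum runs over the representatives picked by the enumeration; for a quotient this means one
-- element of each class.
sumOver : (X : FinSet a ℓ) → (Carrier X → ℕ) → ℕ
sumOver X g = ℕΣ.sum (g ∘ FinSet.element X)

sumOver-cong : (X : FinSet a ℓ) {g h : Carrier X → ℕ} →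
               (∀ x → g x ≡ h x) → sumOver X g ≡ sumOver X h
sumOver-cong X g≗h = ℕΣ.sum-cong-≗ {card X} (λ i → g≗h (FinSet.element X i))

sumOver-comm : (X : FinSet a ℓ) (Y : FinSet b r) (g : Carrier X → Carrier Y → ℕ) →
               sumOver X (λ x → sumOver Y (g x)) ≡ sumOver Y (λ y → sumOver X (λ x → g x y))
sumOver-comm X Y g = ℕΣ.∑-comm (λ i j → g (FinSet.element X i) (FinSet.element Y j))

sumOver-*ˡ : (X : FinSet a ℓ) (k : ℕ) (g : Carrier X → ℕ) →
             sumOver X (λ x → k ℕ.* g x) ≡ k ℕ.* sumOver X g
sumOver-*ˡ X k g = sym (ℕS.*-distribˡ-sum {card X} k (g ∘ FinSet.element X))

sumOver-*ʳ : (X : FinSet a ℓ) (g : Carrier X → ℕ) (k : ℕ) →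
             sumOver X (λ x → g x ℕ.* k) ≡ sumOver X g ℕ.* k
sumOver-*ʳ X g k = sym (ℕS.*-distribʳ-sum {card X} k (g ∘ FinSet.element X))

sumOver-1 : (X : FinSet a ℓ) → sumOver X (λ _ → 1) ≡ card X
sumOver-1 X = go (card X)
  where
  go : ∀ k → ℕΣ.sum {k} (λ _ → 1) ≡ k
  go zero    = refl
  go (suc k) = cong suc (go k)

count-tabulate≡sum : {P : U.Pred A p} (P? : U.Decidable P) → ∀ {k} (g : Fin k → A) →
                     count P? (tabulate g) ≡ ℕΣ.sum (λ i → 𝟙 (P? (g i)))
count-tabulate≡sum P? {zero}  g = refl
count-tabulate≡sum P? {suc k} g with ih ← count-tabulate≡sum P? (g ∘ suc) | does (P? (g zero))
... | true  = cong suc ih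
... | false = ih

#≡sumOver : (X : FinSet a ℓ) {P : U.Pred (Carrier X) p} (P? : U.Decidable P) →
            # X P? ≡ sumOver X (λ x → 𝟙 (P? x))
#≡sumOver X P? = count-tabulate≡sum P? (FinSet.element X)

#-none : (X : FinSet a ℓ) {P : U.Pred (Carrier X) p} (P? : U.Decidable P) →
         (∀ x → ¬ P x) → # X P? ≡ 0
#-none X P? ¬P = count-none P? ¬P (tabulate (FinSet.element X))

-- Double counting of the pairs related by `R`.
sumOver-# : (X : FinSet a ℓ) (Y : FinSet b r) {R : Carrier X → Carrier Y → Set p}
            (R? : ∀ x y → Dec (R x y)) →
            sumOver X (λ x → # Y (R? x)) ≡ sumOver Y (λ y → # X (λ x → R? x y))
sumOver-# X Y R? = begin
  sumOver X (λ x → # Y (R? x))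
    ≡⟨ sumOver-cong X (λ x → #≡sumOver Y (R? x)) ⟩
  sumOver X (λ x → sumOver Y (λ y → 𝟙 (R? x y)))
    ≡⟨ sumOver-comm X Y (λ x y → 𝟙 (R? x y)) ⟩
  sumOver Y (λ y → sumOver X (λ x → 𝟙 (R? x y)))
    ≡⟨ sumOver-cong Y (λ y → #≡sumOver X (λ x → R? x y)) ⟨
  sumOver Y (λ y → # X (λ x → R? x y)) ∎
  where open ≡-Reasoning

sumOver-singleton : (X : FinSet a ℓ) → ∀ x → sumOver X (λ y → 𝟙 (FinSet._≟_ X y x)) ≡ 1
sumOver-singleton X x = trans
  (ℕΣ.sum-cong-≗ {X.card} (λ j → 𝟙-cong (X.element j X.≟ x) (X.index x Fin.≟ j)
    (λ eq → trans (X.index-cong (Setoid.sym X.setoid eq)) (X.index-element j))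
    (λ { refl → X.element-index x })))
  (sum-indicator (X.index x))
  where module X = FinSet X

#-singleton : (X : FinSet a ℓ) → ∀ x → # X (FinSet._≟_ X x) ≡ 1
#-singleton X x = begin
  # X (X._≟_ x)                     ≡⟨ #≡sumOver X (X._≟_ x) ⟩
  sumOver X (λ y → 𝟙 (x X.≟ y))     ≡⟨ sumOver-cong X (λ y → 𝟙-cong (x X.≟ y) (y X.≟ x)
                                         (Setoid.sym X.setoid) (Setoid.sym X.setoid)) ⟩
  sumOver X (λ y → 𝟙 (y X.≟ x))     ≡⟨ sumOver-singleton X x ⟩
  1                                 ∎
  where
  open ≡-Reasoning
  module X = FinSet X

-- Each `x` lies over exactly one `y`, so the factor 1 = Σ_y [y = h x] can be inserted and the two
-- sums exchanged.
sumOver-fibres : (X : FinSet a ℓ) (Y : FinSet b r) (h : Carrier X → Carrier Y) (g : Carrier X → ℕ) →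
                 sumOver X g ≡ sumOver Y (λ y → sumOver X (λ x → 𝟙 (FinSet._≟_ Y y (h x)) ℕ.* g x))
sumOver-fibres X Y h g = begin
  sumOver X g
    ≡⟨ sumOver-cong X (λ x → ℕ.*-identityˡ (g x)) ⟨
  sumOver X (λ x → 1 ℕ.* g x)
    ≡⟨ sumOver-cong X (λ x → cong (ℕ._* g x) (sumOver-singleton Y (h x))) ⟨
  sumOver X (λ x → sumOver Y (λ y → 𝟙 (FinSet._≟_ Y y (h x))) ℕ.* g x)
    ≡⟨ sumOver-cong X (λ x → sumOver-*ʳ Y (λ y → 𝟙 (FinSet._≟_ Y y (h x))) (g x)) ⟨
  sumOver X (λ x → sumOver Y (λ y → 𝟙 (FinSet._≟_ Y y (h x)) ℕ.* g x))
    ≡⟨ sumOver-comm X Y (λ x y → 𝟙 (FinSet._≟_ Y y (h x)) ℕ.* g x) ⟩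
  sumOver Y (λ y → sumOver X (λ x → 𝟙 (FinSet._≟_ Y y (h x)) ℕ.* g x)) ∎
  where open ≡-Reasoning

module _ (Γ : FiniteGroup c ℓ) where
  open FiniteGroup Γ using (group; finSet)
  private
    module G = Group group
    module E = FinSet finSet

  -- Right multiplication by `β` permutes the enumeration of Γ, with inverse the multiplication by
  -- `β ⁻¹`. `Q-resp` is applied because an enumerated element agrees with the product it represents
  -- only up to `≈`.
  #-translate : ∀ β {P : U.Pred G.Carrier p} {Q : U.Pred G.Carrier q}
                (P? : U.Decidable P) (Q? : U.Decidable Q) →
                (∀ {γ δ} → γ G.≈ δ → Q γ → Q δ) →
                (∀ γ → P γ → Q (γ G.∙ β)) → (∀ γ → Q (γ G.∙ β) → P γ) →
                # finSet P? ≡ # finSet Q?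
  #-translate β {Q = Q} P? Q? Q-resp to from = begin
    # finSet P?                           ≡⟨ count-tabulate P? Q? E.element (E.element ∘ mul β)
                                               (λ i → Q-resp (G.sym (E.element-index _)) ∘ to _)
                                               (λ i → from _ ∘ Q-resp (E.element-index _)) ⟩
    count Q? (tabulate (E.element ∘ mul β))       ≡⟨ count-tabulate≡sum Q? (E.element ∘ mul β) ⟩
    ℕΣ.sum (λ i → 𝟙 (Q? (E.element (mul β i))))   ≡⟨ ℕΣ.sum-permute (λ i → 𝟙 (Q? (E.element i))) π ⟨
    ℕΣ.sum (λ i → 𝟙 (Q? (E.element i)))           ≡⟨ #≡sumOver finSet Q? ⟨
    # finSet Q?                           ∎
    where
    open ≡-Reasoning
    mul : G.Carrier → Fin E.card → Fin E.card
    mul δ i = E.index (E.element i G.∙ δ)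

    cancel : ∀ δ δ′ → δ G.∙ δ′ G.≈ G.ε → ∀ i → mul δ′ (mul δ i) ≡ i
    cancel δ δ′ δδ′≈ε i = trans
      (E.index-cong (G.trans (G.∙-congʳ (E.element-index _))
        (G.trans (G.assoc _ δ δ′) (G.trans (G.∙-congˡ δδ′≈ε) (G.identityʳ _)))))
      (E.index-element i)

    π : Permutation′ E.card
    π = permutation (mul β) (mul (β G.⁻¹))
          (cancel (β G.⁻¹) β (G.inverseˡ β)) (cancel β (β G.⁻¹) (G.inverseʳ β))

-- Orbit counting

module _ {Γ : FiniteGroup c ℓ} (F : ΓSpecies Γ f e) where
  open ΓSpecies F hiding (module Γ)
  open FiniteGroup Γ using (finSet; order)
  private module F/Γ = Species (quotientSpecies F)

  -- If β·x = y then γ·y = (γβ)·x, so right translation by β matches the two sets of group elements.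
  #-transporter : ∀ A {x y} → SameOrbit A x y → ∀ s →
    # finSet (λ γ → FinSet._≟_ (F₀ A) (act γ A ⟨$⟩ y) s) ≡
    # finSet (λ γ → FinSet._≟_ (F₀ A) (act γ A ⟨$⟩ x) s)
  #-transporter A {x} {y} (β , βx≈y) s = #-translate Γ β _ _
    (λ γ≈δ → S.trans (S.sym (act-cong γ≈δ A x)))
    (λ γ → S.trans (βγ γ))
    (λ γ → S.trans (S.sym (βγ γ)))
    where
    module S = Setoid (FinSet.setoid (F₀ A))
    βγ : ∀ γ → act (FiniteGroup._∙_ Γ γ β) A ⟨$⟩ x S.≈ act γ A ⟨$⟩ y
    βγ γ = S.trans (act-∙ γ β A x) (Func.cong (act γ A) βx≈y)

  -- Every γ sends `x` to exactly one `s`. This count takes the place of the orbit-stabiliser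
  -- theorem.
  sumOver-transporter : ∀ A x →
    sumOver (F₀ A) (λ s → # finSet (λ γ → FinSet._≟_ (F₀ A) (act γ A ⟨$⟩ x) s)) ≡ order
  sumOver-transporter A x = begin
    sumOver (F₀ A) (λ s → # finSet (λ γ → act γ A ⟨$⟩ x ≟ s))
      ≡⟨ sumOver-# (F₀ A) finSet (λ s γ → act γ A ⟨$⟩ x ≟ s) ⟩
    sumOver finSet (λ γ → # (F₀ A) (λ s → act γ A ⟨$⟩ x ≟ s))
      ≡⟨ sumOver-cong finSet (λ γ → #-singleton (F₀ A) (act γ A ⟨$⟩ x)) ⟩
    sumOver finSet (λ _ → 1)
      ≡⟨ sumOver-1 finSet ⟩
    order ∎
    where
    open ≡-Reasoning
    open FinSet (F₀ A) using () renaming (_≟_ to infix 4 _≟_)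

  module _ {A : FinSet 0ℓ 0ℓ} (σ : A ≃ A) where
    private
      module O = IsEquivalence (sameOrbit-isEquivalence A)
      open FinSet (F₀ A) using () renaming (_≟_ to infix 4 _≟_)
      open FinSet (F/Γ.F₀ A) using () renaming (_≟_ to infix 4 _≟ᵒ_)

      φ : F₀ A ⟶ F₀ A
      φ = F₁ {A} {A} σ

      φᵒ : F/Γ.F₀ A ⟶ F/Γ.F₀ A
      φᵒ = F/Γ.F₁ {A} {A} σ

    -- On the right the condition that `s` lies in the orbit of `x` is absorbed by the count, which
    -- vanishes off that orbit; the remaining indicator is constant in `s` and can be pulled out of
    -- the sum.
    orbit-contribution : ∀ x s →
      𝟙 (x ≟ᵒ s) ℕ.* # finSet (λ γ → act γ A ⟨$⟩ (φ ⟨$⟩ s) ≟ s) ≡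
      𝟙 (φᵒ ⟨$⟩ x ≟ᵒ x) ℕ.* # finSet (λ γ → act γ A ⟨$⟩ x ≟ s)
    orbit-contribution x s = 𝟙-*-cong (x ≟ᵒ s) (φᵒ ⟨$⟩ x ≟ᵒ x)
      -- Here x ~ φ(x) ~ φ(s), so `x` and φ(s) have equinumerous transporters to `s`.
      (λ x~s φx~x → #-transporter A (O.trans (O.sym φx~x) (Func.cong φᵒ x~s)) s)
      -- Some γ with γ·φ(s) = s would give φ(x) ~ φ(s) ~ s ~ x.
      (λ x~s φx≁x → #-none finSet _ (λ γ γφs≈s →
        φx≁x (O.trans (Func.cong φᵒ x~s) (O.trans (γ , γφs≈s) (O.sym x~s)))))
      (λ x≁s _ → #-none finSet _ (λ γ γx≈s → x≁s (γ , γx≈s)))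

    -- When φ acts as the identity this is the Cauchy-Frobenius orbit-counting lemma.
    sum-fix : sumOver finSet (λ γ → fix (F₀ A) (γ ·F₁ σ)) ≡
              fix (F/Γ.F₀ A) φᵒ ℕ.* order
    sum-fix = begin
      sumOver finSet (λ γ → fix (F₀ A) (γ ·F₁ σ))
        ≡⟨ sumOver-# finSet (F₀ A) (λ γ s → act γ A ⟨$⟩ (φ ⟨$⟩ s) ≟ s) ⟩
      sumOver (F₀ A) (λ s → # finSet (λ γ → act γ A ⟨$⟩ (φ ⟨$⟩ s) ≟ s))
        -- The orbit set has the same carrier as `F₀ A`, so the identity function is the projection
        -- onto orbits.
        ≡⟨ sumOver-fibres (F₀ A) (F/Γ.F₀ A) (λ s → s)
             (λ s → # finSet (λ γ → act γ A ⟨$⟩ (φ ⟨$⟩ s) ≟ s)) ⟩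
      sumOver (F/Γ.F₀ A) (λ x → sumOver (F₀ A) (λ s →
        𝟙 (x ≟ᵒ s) ℕ.* # finSet (λ γ → act γ A ⟨$⟩ (φ ⟨$⟩ s) ≟ s)))
        ≡⟨ sumOver-cong (F/Γ.F₀ A) (λ x → sumOver-cong (F₀ A) (orbit-contribution x)) ⟩
      sumOver (F/Γ.F₀ A) (λ x → sumOver (F₀ A) (λ s →
        𝟙 (φᵒ ⟨$⟩ x ≟ᵒ x) ℕ.* # finSet (λ γ → act γ A ⟨$⟩ x ≟ s)))
        ≡⟨ sumOver-cong (F/Γ.F₀ A) (λ x →
             sumOver-*ˡ (F₀ A) (𝟙 (φᵒ ⟨$⟩ x ≟ᵒ x)) (λ s → # finSet (λ γ → act γ A ⟨$⟩ x ≟ s))) ⟩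
      sumOver (F/Γ.F₀ A) (λ x → 𝟙 (φᵒ ⟨$⟩ x ≟ᵒ x) ℕ.*
        sumOver (F₀ A) (λ s → # finSet (λ γ → act γ A ⟨$⟩ x ≟ s)))
        ≡⟨ sumOver-cong (F/Γ.F₀ A) (λ x →
             cong (𝟙 (φᵒ ⟨$⟩ x ≟ᵒ x) ℕ.*_) (sumOver-transporter A x)) ⟩
      sumOver (F/Γ.F₀ A) (λ x → 𝟙 (φᵒ ⟨$⟩ x ≟ᵒ x) ℕ.* order)
        ≡⟨ sumOver-*ʳ (F/Γ.F₀ A) (λ x → 𝟙 (φᵒ ⟨$⟩ x ≟ᵒ x)) order ⟩
      sumOver (F/Γ.F₀ A) (λ x → 𝟙 (φᵒ ⟨$⟩ x ≟ᵒ x)) ℕ.* order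
        ≡⟨ cong (ℕ._* order) (#≡sumOver (F/Γ.F₀ A) (λ x → φᵒ ⟨$⟩ x ≟ᵒ x)) ⟨
      fix (F/Γ.F₀ A) φᵒ ℕ.* order ∎
      where open ≡-Reasoning

-- Rational coefficients

-- Passing to unnormalised fractions avoids reduction to lowest terms; there all denominators are 1
-- and an integer identity remains.
ℕ⇒ℚ-+ : ∀ m n → ℕ⇒ℚ (m ℕ.+ n) ≡ ℕ⇒ℚ m ℚ.+ ℕ⇒ℚ n
ℕ⇒ℚ-+ m n = ℚ.toℚᵘ-injective (begin
  ℚ.toℚᵘ (ℕ⇒ℚ (m ℕ.+ n))               ≈⟨ ℚ.toℚᵘ-fromℚᵘ (ι (m ℕ.+ n)) ⟩
  ι (m ℕ.+ n)                          ≈⟨ ι-+ ⟩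
  ι m ℚᵘ.+ ι n                         ≈⟨ ℚᵘ.+-cong (ℚ.toℚᵘ-fromℚᵘ (ι m)) (ℚ.toℚᵘ-fromℚᵘ (ι n)) ⟨
  ℚ.toℚᵘ (ℕ⇒ℚ m) ℚᵘ.+ ℚ.toℚᵘ (ℕ⇒ℚ n)   ≈⟨ ℚ.toℚᵘ-homo-+ (ℕ⇒ℚ m) (ℕ⇒ℚ n) ⟨
  ℚ.toℚᵘ (ℕ⇒ℚ m ℚ.+ ℕ⇒ℚ n)             ∎)
  where
  open import Relation.Binary.Reasoning.Setoid ℚᵘ.≃-setoid
  ι : ℕ → ℚᵘ.ℚᵘ
  -- `mkℚᵘ` stores the denominator minus one, so 0 stands for denominator 1.
  ι k = ℚᵘ.mkℚᵘ (ℤ.+ k) 0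
  ι-+ : ι (m ℕ.+ n) ℚᵘ.≃ ι m ℚᵘ.+ ι n
  ι-+ = ℚᵘ.*≡* (cong (ℤ._* ℤ.1ℤ) (sym (cong₂ ℤ._+_ (ℤ.*-identityʳ (ℤ.+ m)) (ℤ.*-identityʳ (ℤ.+ n)))))

ℕ⇒ℚ-sum : ∀ {k} (g : Fin k → ℕ) → ℕ⇒ℚ (ℕΣ.sum g) ≡ ℚΣ.sum (ℕ⇒ℚ ∘ g)
ℕ⇒ℚ-sum {zero}  g = refl
ℕ⇒ℚ-sum {suc k} g = trans (ℕ⇒ℚ-+ (g zero) _) (cong (ℕ⇒ℚ (g zero) ℚ.+_) (ℕ⇒ℚ-sum (g ∘ suc)))

1/k*[n*k] : ∀ k n .{{_ : ℕ.NonZero k}} → (ℤ.+ 1 ℚ./ k) ℚ.* ℕ⇒ℚ (n ℕ.* k) ≡ ℕ⇒ℚ n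
1/k*[n*k] k@(suc k-1) n = ℚ.toℚᵘ-injective (begin
  ℚ.toℚᵘ ((ℤ.+ 1 ℚ./ k) ℚ.* ℕ⇒ℚ (n ℕ.* k))               ≈⟨ ℚ.toℚᵘ-homo-* (ℤ.+ 1 ℚ./ k) (ℕ⇒ℚ (n ℕ.* k)) ⟩
  ℚ.toℚᵘ (ℤ.+ 1 ℚ./ k) ℚᵘ.* ℚ.toℚᵘ (ℕ⇒ℚ (n ℕ.* k))       ≈⟨ ℚᵘ.*-cong (ℚ.toℚᵘ-fromℚᵘ 1/k) (ℚ.toℚᵘ-fromℚᵘ (ι (n ℕ.* k))) ⟩
  1/k ℚᵘ.* ι (n ℕ.* k)                                   ≈⟨ ℚᵘ.*≡* cross ⟩
  ι n                                                    ≈⟨ ℚ.toℚᵘ-fromℚᵘ (ι n) ⟨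
  ℚ.toℚᵘ (ℕ⇒ℚ n)                                         ∎)
  where
  open import Relation.Binary.Reasoning.Setoid ℚᵘ.≃-setoid
  ι : ℕ → ℚᵘ.ℚᵘ
  ι j = ℚᵘ.mkℚᵘ (ℤ.+ j) 0
  1/k : ℚᵘ.ℚᵘ
  1/k = ℚᵘ.mkℚᵘ (ℤ.+ 1) k-1
  -- The cross-multiplied form of (1/k)·(nk/1) = n/1.
  cross : ℤ.+ 1 ℤ.* ℤ.+ (n ℕ.* k) ℤ.* ℤ.+ 1 ≡ ℤ.+ n ℤ.* ℤ.+ (k ℕ.* 1)
  cross = trans (ℤ.*-identityʳ _) (trans (ℤ.*-identityˡ _)
    (trans (ℤ.pos-* n k) (cong (λ j → ℤ.+ n ℤ.* ℤ.+ j) (sym (ℕ.*-identityʳ k)))))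

-- s and ss stay abstract because unfolding the concrete bound makes
-- conversion checking prohibitively slow.
∑∞-•-∑ : (X : FinSet a ℓ) (x : ℚ) (s : ℕ → PowerSeries) (ss : Summable s)
         (t : Carrier X → ℕ → PowerSeries) (ts : ∀ y → Summable (t y)) →
         (∀ y m → proj₁ (ts y m) ≡ proj₁ (ss m)) →
         (∀ n → s n ≋ x • ∑[ y ∈ X ] t y n) →
         ∑∞ s ss ≋ x • ∑[ y ∈ X ] ∑∞ (t y) (ts y)
∑∞-•-∑ X x s ss t ts same-bound s≋ m = begin
  sumBelow N (λ n → s n ⟨$⟩ m)
    ≡⟨ ℚΣ.sum-cong-≗ {N} (λ n → s≋ (toℕ n) m) ⟩
  sumBelow N (λ n → x ℚ.* ℚΣ.sum {card X} (λ i → t (y i) n ⟨$⟩ m))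
    ≡⟨ ℚS.*-distribˡ-sum {N} x (λ n → ℚΣ.sum {card X} (λ i → t (y i) (toℕ n) ⟨$⟩ m)) ⟨
  x ℚ.* sumBelow N (λ n → ℚΣ.sum {card X} (λ i → t (y i) n ⟨$⟩ m))
    ≡⟨ cong (x ℚ.*_) (ℚΣ.∑-comm {card X} {N} (λ i n → t (y i) (toℕ n) ⟨$⟩ m)) ⟨
  x ℚ.* ℚΣ.sum {card X} (λ i → sumBelow N (λ n → t (y i) n ⟨$⟩ m))
    -- Each inner series is truncated at its own bound, which `same-bound` identifies with `N`; only
    -- then are the sums over one rectangle.
    ≡⟨ cong (x ℚ.*_) (ℚΣ.sum-cong-≗ {card X} (λ i →
         cong (λ M → sumBelow M (λ n → t (y i) n ⟨$⟩ m)) (same-bound (y i) m))) ⟨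
  x ℚ.* ℚΣ.sum {card X} (λ i → sumBelow (proj₁ (ts (y i) m)) (λ n → t (y i) n ⟨$⟩ m)) ∎
  where
  open ≡-Reasoning
  N = proj₁ (ss m)
  y = FinSet.element X

-- Averaging permutation-indexed series over Γ

permutationSum : (∀ n → Permutation′ n → ℕ) → ℕ → PowerSeries
permutationSum w n = 1/ n ! • ∑[ σ ∈ 𝔖 n ] ℕ⇒ℚ (w n σ) • p⟨ σ ⟩

-- With `w n σ` equal to fix(F[σ]) or fix(γ·F[σ]) this is definitionally `cycleIndex` or
-- `ΓcycleIndex`.
permutationSeries : (∀ n → Permutation′ n → ℕ) → PowerSeries
permutationSeries w = ∑∞ (permutationSum w) (permutationSums-summable w)

module _ (Γ : FiniteGroup c ℓ) where
  open FiniteGroup Γ using (finSet; order; ε)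

  module _ (v : ∀ n → Permutation′ n → ℕ) (w : Carrier finSet → ∀ n → Permutation′ n → ℕ)
           (Σw≡v*order : ∀ n σ → sumOver finSet (λ γ → w γ n σ) ≡ v n σ ℕ.* order) where
    private
      elem : Fin order → Carrier finSet
      elem = FinSet.element finSet

    average-weight : ∀ n σ → ℕ⇒ℚ (v n σ) ≡ 1/∣ Γ ∣ ℚ.* ℚΣ.sum (λ i → ℕ⇒ℚ (w (elem i) n σ))
    average-weight n σ = begin
      ℕ⇒ℚ (v n σ)
        -- The order is nonzero because Γ contains `ε`.
        ≡⟨ 1/k*[n*k] order (v n σ) {{Fin.nonZeroIndex (FinSet.index finSet ε)}} ⟨
      1/∣ Γ ∣ ℚ.* ℕ⇒ℚ (v n σ ℕ.* order)
        ≡⟨ cong (λ k → 1/∣ Γ ∣ ℚ.* ℕ⇒ℚ k) (Σw≡v*order n σ) ⟨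
      1/∣ Γ ∣ ℚ.* ℕ⇒ℚ (sumOver finSet (λ γ → w γ n σ))
        ≡⟨ cong (1/∣ Γ ∣ ℚ.*_) (ℕ⇒ℚ-sum {order} (λ i → w (elem i) n σ)) ⟩
      1/∣ Γ ∣ ℚ.* ℚΣ.sum {order} (λ i → ℕ⇒ℚ (w (elem i) n σ)) ∎
      where open ≡-Reasoning

    -- At each monomial, every weight is replaced by its average over Γ; then the finite sums over
    -- permutations and over Γ are exchanged and the two scalars commuted.
    average-permutationSum : ∀ n →
      permutationSum v n ≋ 1/∣ Γ ∣ • ∑[ γ ∈ finSet ] permutationSum (w γ) n
    average-permutationSum n m = begin
      1/ n ! ℚ.* ℚΣ.sum {n !} (λ j → ℕ⇒ℚ (v n (perm j)) ℚ.* mono j)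
        ≡⟨ cong (1/ n ! ℚ.*_) (ℚΣ.sum-cong-≗ {n !} coefficient) ⟩
      1/ n ! ℚ.* ℚΣ.sum {n !} (λ j → 1/∣ Γ ∣ ℚ.* ℚΣ.sum {order} (λ i → term i j))
        ≡⟨ cong (1/ n ! ℚ.*_) (ℚS.*-distribˡ-sum {n !} 1/∣ Γ ∣ (λ j → ℚΣ.sum {order} (λ i → term i j))) ⟨
      1/ n ! ℚ.* (1/∣ Γ ∣ ℚ.* ℚΣ.sum {n !} (λ j → ℚΣ.sum {order} (λ i → term i j)))
        ≡⟨ cong (λ x → 1/ n ! ℚ.* (1/∣ Γ ∣ ℚ.* x)) (ℚΣ.∑-comm {order} {n !} term) ⟨
      1/ n ! ℚ.* (1/∣ Γ ∣ ℚ.* ℚΣ.sum {order} (λ i → ℚΣ.sum {n !} (term i)))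
        ≡⟨ x∙yz≈y∙xz (1/ n !) 1/∣ Γ ∣ _ ⟩
      1/∣ Γ ∣ ℚ.* (1/ n ! ℚ.* ℚΣ.sum {order} (λ i → ℚΣ.sum {n !} (term i)))
        ≡⟨ cong (1/∣ Γ ∣ ℚ.*_) (ℚS.*-distribˡ-sum {order} (1/ n !) (λ i → ℚΣ.sum {n !} (term i))) ⟩
      1/∣ Γ ∣ ℚ.* ℚΣ.sum {order} (λ i → 1/ n ! ℚ.* ℚΣ.sum {n !} (term i)) ∎
      where
      open ≡-Reasoning
      perm : Fin (n !) → Permutation′ n
      perm = FinSet.element (𝔖 n)
      mono : Fin (n !) → ℚ
      mono j = p⟨ perm j ⟩ ⟨$⟩ m
      term : Fin order → Fin (n !) → ℚ
      term i j = ℕ⇒ℚ (w (elem i) n (perm j)) ℚ.* mono j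
      coefficient : ∀ j → ℕ⇒ℚ (v n (perm j)) ℚ.* mono j ≡ 1/∣ Γ ∣ ℚ.* ℚΣ.sum {order} (λ i → term i j)
      coefficient j = begin
        ℕ⇒ℚ (v n (perm j)) ℚ.* mono j
          ≡⟨ cong (ℚ._* mono j) (average-weight n (perm j)) ⟩
        1/∣ Γ ∣ ℚ.* ℚΣ.sum {order} (λ i → ℕ⇒ℚ (w (elem i) n (perm j))) ℚ.* mono j
          ≡⟨ ℚ.*-assoc 1/∣ Γ ∣ _ (mono j) ⟩
        1/∣ Γ ∣ ℚ.* (ℚΣ.sum {order} (λ i → ℕ⇒ℚ (w (elem i) n (perm j))) ℚ.* mono j)
          ≡⟨ cong (1/∣ Γ ∣ ℚ.*_) (ℚS.*-distribʳ-sum {order} (mono j) (λ i → ℕ⇒ℚ (w (elem i) n (perm j)))) ⟩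
        1/∣ Γ ∣ ℚ.* ℚΣ.sum {order} (λ i → term i j) ∎

    average-permutationSeries :
      permutationSeries v ≋ 1/∣ Γ ∣ • ∑[ γ ∈ finSet ] permutationSeries (w γ)
    average-permutationSeries = ∑∞-•-∑ finSet 1/∣ Γ ∣
      (permutationSum v) (permutationSums-summable v)
      (λ γ → permutationSum (w γ)) (λ γ → permutationSums-summable (w γ))
      -- The bound given by `permutationSums-summable` is one more than `degreeBound m` for all
      -- weights, so the truncations coincide by computation.
      (λ _ _ → refl) average-permutationSum

mainTheorem4 :
    ∀ {c ℓ f e} (Γ : FiniteGroup c ℓ) (F : ΓSpecies Γ f e) →
    let open FiniteGroup Γ using (finSet)
        open ΓSpecies F hiding (module Γ)
    in
    (cycleIndex (quotientSpecies F) ≋ 1/∣ Γ ∣ • ∑[ γ ∈ finSet ] ΓcycleIndex F γ)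
    ×
    (1/∣ Γ ∣ • ∑[ γ ∈ finSet ] ΓcycleIndex F γ
      ≋ 1/∣ Γ ∣ • ∑[ γ ∈ finSet ]
          ∑∞ (λ n → 1/ n ! • ∑[ σ ∈ 𝔖 n ] ℕ⇒ℚ (fix (F₀ ⟦ n ⟧) (γ ·F₁ σ)) • p⟨ σ ⟩)
             (permutationSums-summable (λ n σ → fix (F₀ ⟦ n ⟧) (γ ·F₁ σ))))
mainTheorem4 Γ F =
  -- Orbit counting at each `⟦ n ⟧` and `σ` supplies the hypothesis on the weights.
  average-permutationSeries Γ (λ n σ → fix (F/Γ.F₀ ⟦ n ⟧) (F/Γ.F₁ σ))
            (λ γ n σ → fix (F.F₀ ⟦ n ⟧) (γ F.·F₁ σ))
            (λ n σ → sum-fix F {⟦ n ⟧} σ)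
  -- The second equality unfolds `ΓcycleIndex`.
  , (λ m → refl)
  where
  module F = ΓSpecies F
  module F/Γ = Species (quotientSpecies F)
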